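{- Let $\mathcal P$ be a special poset. Then $\text{sat}^*(n,\mathcal P)=O(n)$.
   Context: A finite poset $\mathcal P$ is special if it consists of a poset $\mathcal P'$ having both a unique minimal and a unique maximal element, together with one additional element that is incomparable to every element of $\mathcal P'$. A poset $\mathcal Q$ contains an induced copy of a poset $\mathcal P$ if there is an injective map $f:\mathcal P\to\mathcal Q$ with $f(x)\le f(y)$ iff $x\le y$. A family $\mathcal F$ of subsets of $[n]$ (ordered by inclusion) is $\mathcal P$-saturated if $\mathcal F$ contains no induced copy of $\mathcal P$ but for every $S\subseteq[n]$ with $S\notin\mathcal F$, $\mathcal F\cup\{S\}$ contains an induced copy of $\mathcal P$; $\text{sat}^*(n,\mathcal P)$ is the minimum size of a $\mathcal P$-saturated family of subsets of $[n]$. -}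

module Defs where

open import Data.Nat using (ℕ)
open import Data.Fin using (Fin)
open import Data.Fin.Subset using (Subset; _⊆_)
open import Data.List using (List; _∷_; length)
open import Data.List.Membership.Propositional using (_∈_)
open import Data.List.Relation.Unary.Unique.Propositional using (Unique)
open import Data.Product using (Σ; ∃; ∃-syntax; _×_; _,_)
open import Relation.Binary.PropositionalEquality using (_≡_)
open import Relation.Binary.Structures using (IsPartialOrder)
open import Relation.Nullary using (¬_)
open import Function.Bundles using (_⇔_)
open import Function.Definitions using (Injective)

record FinPoset : Set₁ where
  field
    size           : ℕ
    _≼_            : Fin size → Fin size → Set
    isPartialOrder : IsPartialOrder _≡_ _≼_

module _ (P : FinPoset) where
  open FinPoset P

  MinimalOutside : Fin size → Fin size → Set
  MinimalOutside a b = ¬ (b ≡ a) × (∀ d → ¬ (d ≡ a) → d ≼ b → d ≡ b)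

  MaximalOutside : Fin size → Fin size → Set
  MaximalOutside a b = ¬ (b ≡ a) × (∀ d → ¬ (d ≡ a) → b ≼ d → d ≡ b)

  IsSpecial : Set
  IsSpecial = ∃[ a ]
      ((∀ x → ¬ (x ≡ a) → ¬ (a ≼ x) × ¬ (x ≼ a))
    × (∃[ b ] (MinimalOutside a b × (∀ c → MinimalOutside a c → c ≡ b)))
    × (∃[ t ] (MaximalOutside a t × (∀ c → MaximalOutside a c → c ≡ t))))

-- A family of subsets of [n]: a duplicate-free list of subsets; its size is its length.
Family : ℕ → Set
Family n = List (Subset n)

ContainsCopy : (n : ℕ) → FinPoset → List (Subset n) → Set
ContainsCopy n P F =
  ∃[ f ] ((∀ x → f x ∈ F) × Injective _≡_ _≡_ f × (∀ x y → (x ≼ y) ⇔ (f x ⊆ f y)))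
  where open FinPoset P

IsSaturated : (n : ℕ) → FinPoset → List (Subset n) → Set
IsSaturated n P F =
  Unique F × ¬ ContainsCopy n P F
  × (∀ (S : Subset n) → ¬ (S ∈ F) → ContainsCopy n P (S ∷ F))

SatStar : ℕ → FinPoset → ℕ → Set
SatStar n P k =
  (∃[ F ] (IsSaturated n P F × length F ≡ k))
  × (∀ F → IsSaturated n P F → k Data.Nat.≤ length F)

{-# OPTIONS --safe #-}
-- Let s = |P|, let a be the isolated point and cut [n] into consecutive blocks of length s.
-- The sets {v < j s} ∪ (j s + ↓x) with x ≠ a form, for each full block j, an induced copy of
-- P ∖ {a}, and sets from different blocks are comparable.  In a copy of P inside the family of
-- all these sets, every other set is incomparable to the image of a, so all lie in one block,
-- which has only s - 1 members.  So this family is P-free and extends to a saturated family F.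
-- Each X in F is comparable to some member of each block j (otherwise X and that block form a
-- copy of P), so X contains {v < j s} or lies in {v < (j+1) s}.  Hence X is determined, for some
-- j ≤ n / s, by its trace on a window of length 2 s starting at j s, and |F| ≤ (n / s + 1) 4^s.
-- The order of P need not be decidable; the bound is, so the argument runs under double negation.
module Submission where

open import Defs
open import Data.Nat using (ℕ; zero; suc; _≤_; _*_; _+_; _^_; _<_; _/_; _<?_; z≤n; s≤s)
open import Data.Nat.Properties
open import Data.Nat.DivMod using (m/n*n≤m; m/n≤m; m≡m%n+[m/n]*n; m%n<n)
open import Data.Bool using (true; false)
import Data.Bool.Properties as Bool
open import Data.Empty using (⊥-elim)
open import Data.Fin using (Fin; toℕ; fromℕ<; punchOut)
import Data.Fin as Fin
import Data.Fin.Properties as Finₚ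
open import Data.Fin.Subset using (Subset; _⊆_) renaming (_∈_ to _∈ˢ_)
open import Data.Fin.Subset.Properties using (⊆-antisym; ⊆-refl; ⊆-trans; _⊆?_) renaming (_∈?_ to _∈ˢ?_)
open import Data.List using (List; []; _∷_; length; cartesianProductWith; map; upTo; allFin; filter; deduplicate; _++_)
open import Data.List.Properties using (length-upTo; length-++; length-map)
open import Data.List.Membership.Propositional using (_∈_)
open import Data.List.Membership.Propositional.Properties
  using (∈-∃++; ∈-++⁺ˡ; ∈-++⁺ʳ; ∈-++⁻; ∈-cartesianProductWith⁺; ∈-cartesianProductWith⁻; ∈-deduplicate⁺; ∈-deduplicate⁻;
         ∈-upTo⁺; ∈-filter⁺; ∈-filter⁻; ∈-allFin)
open import Data.List.Relation.Binary.Subset.Propositional using () renaming (_⊆_ to _⊆ˡ_)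
open import Data.List.Relation.Binary.Subset.Propositional.Properties using (∷⁺ʳ)
import Data.List.Relation.Unary.All as All
open import Data.List.Relation.Unary.All.Properties using (¬Any⇒All¬)
open import Data.List.Relation.Unary.AllPairs using ([]; _∷_)
open import Data.List.Relation.Unary.Any using (here; there)
open import Data.List.Relation.Unary.Unique.Propositional using (Unique)
import Data.List.Relation.Unary.Unique.DecPropositional.Properties as UniqueDec
import Data.Vec as Vec
import Data.Vec.Properties as Vecₚ
open import Data.Product using (∃-syntax; _×_; _,_; proj₁; proj₂)
open import Data.Sum using (_⊎_; inj₁; inj₂)
open import Function using (_∘_)
open import Function.Bundles using (_⇔_; mk⇔; Equivalence)
open import Function.Definitions using (Injective)
open import Relation.Binary.Definitions using (DecidableEquality; tri<; tri≈; tri>)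
open import Relation.Binary.PropositionalEquality using (_≡_; refl; sym; trans; cong; cong₂; subst; subst₂)
open import Relation.Binary.Structures using (IsPartialOrder)
open import Relation.Nullary using (¬_; Dec; yes; no; does; contradiction)
open import Relation.Nullary.Decidable using (_×-dec_; _⊎-dec_; ¬?; dec-true; decidable-stable; ¬¬-excluded-middle)
open import Relation.Nullary.Negation using (¬¬-map; ¬¬-Monad)
open import Relation.Unary using (Decidable)
open import Effect.Monad using (RawMonad)
open import Level using (0ℓ)

-- Comprehension, listing of subsets, finite counting

_≟ˢ_ : ∀ {n} → DecidableEquality (Subset n)
_≟ˢ_ = Vecₚ.≡-dec Bool._≟_

module _ {n} {P : Fin n → Set} (P? : Decidable P) where

  comprehension : Subset n
  comprehension = Vec.tabulate (does ∘ P?)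

  ∈-comprehension⁺ : ∀ {v} → P v → v ∈ˢ comprehension
  ∈-comprehension⁺ {v} p =
    Vecₚ.lookup⇒[]= v _ (trans (Vecₚ.lookup∘tabulate _ v) (dec-true (P? v) p))

  ∈-comprehension⁻ : ∀ {v} → v ∈ˢ comprehension → P v
  ∈-comprehension⁻ {v} v∈ with P? v | trans (sym (Vecₚ.lookup∘tabulate (does ∘ P?) v)) (Vecₚ.[]=⇒lookup v∈)
  ... | yes p | _ = p
  ... | no _  | ()

length-cartesianProductWith : ∀ {A B C : Set} (f : A → B → C) xs ys →
  length (cartesianProductWith f xs ys) ≡ length xs * length ys
length-cartesianProductWith f []       ys = refl
length-cartesianProductWith f (x ∷ xs) ys = trans (length-++ (map (f x) ys))
  (cong₂ _+_ (length-map (f x) ys) (length-cartesianProductWith f xs ys))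

subsets : ∀ n → List (Subset n)
subsets zero    = Vec.[] ∷ []
subsets (suc n) = cartesianProductWith Vec._∷_ (true ∷ false ∷ []) (subsets n)

∈-subsets : ∀ {n} (T : Subset n) → T ∈ subsets n
∈-subsets Vec.[]          = here refl
∈-subsets (true Vec.∷ T)  = ∈-cartesianProductWith⁺ Vec._∷_ {xs = true ∷ false ∷ []} (here refl) (∈-subsets T)
∈-subsets (false Vec.∷ T) = ∈-cartesianProductWith⁺ Vec._∷_ {xs = true ∷ false ∷ []} (there (here refl)) (∈-subsets T)

length-subsets : ∀ n → length (subsets n) ≡ 2 ^ n
length-subsets zero    = refl
length-subsets (suc n) = trans
  (length-cartesianProductWith Vec._∷_ (true ∷ false ∷ []) (subsets n))
  (cong (2 *_) (length-subsets n))

-- Delete one occurrence of `x` from `ys`; by uniqueness the tail `xs` still embeds in what is left.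
Unique⇒length≤ : ∀ {A : Set} {xs ys : List A} → Unique xs → xs ⊆ˡ ys → length xs ≤ length ys
Unique⇒length≤ [] _ = z≤n
Unique⇒length≤ {xs = x ∷ xs} (x∉ ∷ uniq) xs⊆ys with ∈-∃++ (xs⊆ys (here refl))
... | us , vs , refl = begin
    suc (length xs)               ≤⟨ s≤s (Unique⇒length≤ uniq xs⊆us++vs) ⟩
    suc (length (us ++ vs))       ≡⟨ cong suc (length-++ us) ⟩
    suc (length us + length vs)   ≡⟨ +-suc (length us) (length vs) ⟨
    length us + suc (length vs)   ≡⟨ length-++ us ⟨
    length (us ++ x ∷ vs)         ∎
  where
  open ≤-Reasoning
  xs⊆us++vs : ∀ {z} → z ∈ xs → z ∈ us ++ vs
  xs⊆us++vs z∈xs with ∈-++⁻ us (xs⊆ys (there z∈xs))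
  ... | inj₁ z∈us            = ∈-++⁺ˡ z∈us
  ... | inj₂ (here refl)     = contradiction refl (All.lookup x∉ z∈xs)
  ... | inj₂ (there z∈vs)    = ∈-++⁺ʳ us z∈vs

-- Punching `a` out of the codomain would inject `Fin (suc m)` into `Fin m`.
injective⇒¬avoids : ∀ {m} {f : Fin m → Fin m} → Injective _≡_ _≡_ f → ∀ a → ¬ (∀ x → ¬ (a ≡ f x))
injective⇒¬avoids {suc m} f-inj a a≢f =
  1+n≰n (Finₚ.injective⇒≤ {f = λ x → punchOut (a≢f x)}
    (λ {x} {y} eq → f-inj (Finₚ.punchOut-injective (a≢f x) (a≢f y) eq)))

-- Greedy extension

module _ {n : ℕ} (P : FinPoset) where

  ContainsCopy-mono : ∀ {F G} → F ⊆ˡ G → ContainsCopy n P F → ContainsCopy n P G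
  ContainsCopy-mono F⊆G (f , f∈ , rest) = f , (λ x → F⊆G (f∈ x)) , rest

  -- Saturation is asked only for the candidates in `Ss`, so that they can be processed one at a
  -- time.
  Extension : List (Subset n) → List (Subset n) → Set
  Extension Ss F = ∃[ G ] (F ⊆ˡ G × Unique G × ¬ ContainsCopy n P G
    × (∀ {S} → S ∈ Ss → ¬ (S ∈ G) → ContainsCopy n P (S ∷ G)))

  -- Each candidate joins the family unless it completes a copy; a rejected one stays rejected,
  -- since copies survive in larger families. Containing a copy is not assumed decidable, hence the
  -- double negation.
  extend : ∀ Ss F → Unique F → ¬ ContainsCopy n P F → ¬ ¬ Extension Ss F
  extend [] F uniq free k = k (F , (λ z → z) , uniq , free , λ ())
  extend (S ∷ Ss) F uniq free k = ¬¬-excluded-middle λ where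
      (yes copy) → extend Ss F uniq free (k ∘ settle (λ z → z) (λ F⊆G _ → ContainsCopy-mono (∷⁺ʳ S F⊆G) copy))
      (no ¬copy) → ¬¬-excluded-middle λ where
        (yes S∈F) → extend Ss F uniq free (k ∘ settle (λ z → z) (λ F⊆G S∉G → contradiction (F⊆G S∈F) S∉G))
        (no S∉F)  → extend Ss (S ∷ F) (¬Any⇒All¬ F S∉F ∷ uniq) ¬copy
          (k ∘ settle there (λ S∷F⊆G S∉G → contradiction (S∷F⊆G (here refl)) S∉G))
    where
    settle : ∀ {E} → F ⊆ˡ E →
      (∀ {G} → E ⊆ˡ G → ¬ (S ∈ G) → ContainsCopy n P (S ∷ G)) →
      Extension Ss E → Extension (S ∷ Ss) F
    settle F⊆E settled (G , E⊆G , uniqG , freeG , sat) = G , E⊆G ∘ F⊆E , uniqG , freeG , λ where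
      (here refl) → settled E⊆G
      (there S∈)  → sat S∈

  extend-to-saturated : ∀ F → Unique F → ¬ ContainsCopy n P F →
    ¬ ¬ (∃[ G ] (F ⊆ˡ G × IsSaturated n P G))
  extend-to-saturated F uniq free = ¬¬-map saturated (extend (subsets n) F uniq free)
    where
    saturated : Extension (subsets n) F → ∃[ G ] (F ⊆ˡ G × IsSaturated n P G)
    saturated (G , F⊆G , uniqG , freeG , sat) = G , F⊆G , uniqG , freeG , λ S → sat (∈-subsets S)

-- Initial segments with a small set stacked on top

module _ {n : ℕ} where

  abstract

    below : ℕ → Subset n
    below b = comprehension (λ v → toℕ v <? b)

    ∈-below⁺ : ∀ {b v} → toℕ v < b → v ∈ˢ below b
    ∈-below⁺ {b} = ∈-comprehension⁺ (λ v → toℕ v <? b)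

    ∈-below⁻ : ∀ {b v} → v ∈ˢ below b → toℕ v < b
    ∈-below⁻ {b} = ∈-comprehension⁻ (λ v → toℕ v <? b)

  below-mono : ∀ {b c} → b ≤ c → below b ⊆ below c
  below-mono b≤c v∈ = ∈-below⁺ (<-≤-trans (∈-below⁻ v∈) b≤c)

  module _ {w : ℕ} where

    -- The translate `b + T`, truncated to `[n]`.
    Shift : ℕ → Subset w → Fin n → Set
    Shift b T v = ∃[ k ] (toℕ v ≡ b + toℕ k × k ∈ˢ T)

    stack? : ∀ b (T : Subset w) → Decidable (λ v → toℕ v < b ⊎ Shift b T v)
    stack? b T v = toℕ v <? b ⊎-dec Finₚ.any? (λ k → toℕ v ≟ b + toℕ k ×-dec k ∈ˢ? T)

    abstract

      stack : ℕ → Subset w → Subset n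
      stack b T = comprehension (stack? b T)

      ∈-stack⁺ : ∀ {b T v} → toℕ v < b ⊎ Shift b T v → v ∈ˢ stack b T
      ∈-stack⁺ {b} {T} = ∈-comprehension⁺ (stack? b T)

      ∈-stack⁻ : ∀ {b T v} → v ∈ˢ stack b T → toℕ v < b ⊎ Shift b T v
      ∈-stack⁻ {b} {T} = ∈-comprehension⁻ (stack? b T)

    below⊆stack : ∀ {b T} → below b ⊆ stack b T
    below⊆stack v∈ = ∈-stack⁺ (inj₁ (∈-below⁻ v∈))

    stack⊆below : ∀ {b T} → stack b T ⊆ below (b + w)
    stack⊆below {b} v∈ with ∈-stack⁻ v∈
    ... | inj₁ v<b            = ∈-below⁺ (<-≤-trans v<b (m≤m+n b w))
    ... | inj₂ (k , v≡ , _)   = ∈-below⁺ (subst (_< b + w) (sym v≡) (+-monoʳ-< b (Finₚ.toℕ<n k)))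

    stack-mono : ∀ {b T U} → T ⊆ U → stack b T ⊆ stack b U
    stack-mono T⊆U v∈ with ∈-stack⁻ v∈
    ... | inj₁ v<b            = ∈-stack⁺ (inj₁ v<b)
    ... | inj₂ (k , v≡ , k∈)  = ∈-stack⁺ (inj₂ (k , v≡ , T⊆U k∈))

    -- As `b + w ≤ n`, truncation loses no point of the translate, and translated points lie outside
    -- the initial segment below `b`.
    stack-cancel : ∀ {b T U} → b + w ≤ n → stack b T ⊆ stack b U → T ⊆ U
    stack-cancel {b} {T} {U} b+w≤n T⊆U {k} k∈T
      with v<n ← <-≤-trans (+-monoʳ-< b (Finₚ.toℕ<n k)) b+w≤n
      with v≡ ← Finₚ.toℕ-fromℕ< v<n
      with ∈-stack⁻ (T⊆U (∈-stack⁺ (inj₂ (k , v≡ , k∈T))))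
    ... | inj₁ v<b = contradiction (subst (_< b) v≡ v<b) (m+n≮m b _)
    ... | inj₂ (l , v≡′ , l∈U) =
      subst (_∈ˢ U) (Finₚ.toℕ-injective (+-cancelˡ-≡ b _ _ (trans (sym v≡′) v≡))) l∈U

    -- `T` is the trace of `X` on the window starting at `b`. The window may overrun `n`; positions
    -- there match no `v` and stay out of `T`.
    squeezed⇒stack : ∀ {b X} → below b ⊆ X → X ⊆ below (b + w) → ∃[ T ] (X ≡ stack b T)
    squeezed⇒stack {b} {X} below⊆X X⊆below = T , ⊆-antisym X⊆stack stack⊆X
      where
      trace? : Decidable (λ k → ∃[ v ] (toℕ v ≡ b + toℕ k × v ∈ˢ X))
      trace? k = Finₚ.any? (λ v → toℕ v ≟ b + toℕ k ×-dec v ∈ˢ? X)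

      T : Subset w
      T = comprehension trace?

      X⊆stack : X ⊆ stack b T
      X⊆stack {v} v∈X with toℕ v <? b
      ... | yes v<b = ∈-stack⁺ (inj₁ v<b)
      ... | no  v≮b with m≤n⇒∃[o]m+o≡n (≮⇒≥ v≮b)
      ...   | o , b+o≡v = ∈-stack⁺ (inj₂ (fromℕ< o<w , v≡ , ∈-comprehension⁺ trace? (v , v≡ , v∈X)))
        where
        o<w : o < w
        o<w = +-cancelˡ-< b o w (subst (_< b + w) (sym b+o≡v) (∈-below⁻ (X⊆below v∈X)))
        v≡ : toℕ v ≡ b + toℕ (fromℕ< o<w)
        v≡ = trans (sym b+o≡v) (cong (b +_) (sym (Finₚ.toℕ-fromℕ< o<w)))

      stack⊆X : stack b T ⊆ X
      stack⊆X v∈ with ∈-stack⁻ v∈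
      ... | inj₁ v<b = below⊆X (∈-below⁺ v<b)
      ... | inj₂ (k , v≡ , k∈T) with ∈-comprehension⁻ trace? k∈T
      ...   | u , u≡ , u∈X = subst (_∈ˢ X) (Finₚ.toℕ-injective (trans u≡ (sym v≡))) u∈X

-- Consecutive blocks, each carrying a copy of `P` without `a`

Isolated : (P : FinPoset) → Fin (FinPoset.size P) → Set
Isolated P a = ∀ x → ¬ (x ≡ a) → ¬ (a ≼ x) × ¬ (x ≼ a)
  where open FinPoset P

module Blocks (P : FinPoset) (_≼?_ : ∀ x y → Dec (FinPoset._≼_ P x y))
  (a : Fin (FinPoset.size P)) (isolated : Isolated P a)
  (n m : ℕ) (m*size≤n : m * FinPoset.size P ≤ n) (n≤[1+m]*size : n ≤ suc m * FinPoset.size P) where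

  open FinPoset P
  open IsPartialOrder isPartialOrder using (antisym) renaming (refl to ≼-refl; trans to ≼-trans)

  -- Principal down-sets embed the order of `P` into inclusion.
  ↓ : Fin size → Subset size
  ↓ x = comprehension (_≼? x)

  ↓-mono : ∀ {x y} → x ≼ y → ↓ x ⊆ ↓ y
  ↓-mono {x} {y} x≼y z∈ = ∈-comprehension⁺ (_≼? y) (≼-trans (∈-comprehension⁻ (_≼? x) z∈) x≼y)

  ↓-cancel : ∀ {x y} → ↓ x ⊆ ↓ y → x ≼ y
  ↓-cancel {x} {y} ↓x⊆↓y = ∈-comprehension⁻ (_≼? y) (↓x⊆↓y (∈-comprehension⁺ (_≼? x) ≼-refl))

  member : ℕ → Fin size → Subset n
  member j x = stack (j * size) (↓ x)

  member⊆below : ∀ {j x} → member j x ⊆ below (suc j * size)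
  member⊆below {j} {x} = subst (λ b → member j x ⊆ below b) (+-comm (j * size) size) stack⊆below

  member-⊆⇔ : ∀ {j} → j < m → ∀ x y → x ≼ y ⇔ member j x ⊆ member j y
  member-⊆⇔ {j} j<m x y = mk⇔ mono cancel
    where
    mono : x ≼ y → member j x ⊆ member j y
    mono x≼y = stack-mono (↓-mono x≼y)

    fits : j * size + size ≤ n
    fits = ≤-trans (≤-reflexive (+-comm (j * size) size)) (≤-trans (*-monoˡ-≤ size j<m) m*size≤n)

    cancel : member j x ⊆ member j y → x ≼ y
    cancel jx⊆jy = ↓-cancel (stack-cancel fits jx⊆jy)

  -- `member i x` stops before block `i + 1`, and `member j y` contains everything before block `j`.
  member-< : ∀ {i j x y} → i < j → member i x ⊆ member j y
  member-< {i} i<j = ⊆-trans (member⊆below {i}) (⊆-trans (below-mono (*-monoˡ-≤ size i<j)) below⊆stack)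

  others : List (Fin size)
  others = filter (λ x → ¬? (x Fin.≟ a)) (allFin size)

  -- Deduplication gives `Unique` without a proof that distinct pairs `j`, `x` yield distinct sets.
  members : List (Subset n)
  members = deduplicate _≟ˢ_ (cartesianProductWith member (upTo m) others)

  members-unique : Unique members
  members-unique = UniqueDec.deduplicate-! _≟ˢ_ (cartesianProductWith member (upTo m) others)

  ∈-members⁺ : ∀ {j x} → j < m → ¬ (x ≡ a) → member j x ∈ members
  ∈-members⁺ j<m x≢a = ∈-deduplicate⁺ _≟ˢ_
    (∈-cartesianProductWith⁺ member (∈-upTo⁺ j<m) (∈-filter⁺ _ (∈-allFin _) x≢a))

  ∈-members⁻ : ∀ {S} → S ∈ members → ∃[ j ] ∃[ x ] (¬ (x ≡ a) × S ≡ member j x)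
  ∈-members⁻ S∈ with ∈-cartesianProductWith⁻ member (upTo m) others (∈-deduplicate⁻ _≟ˢ_ _ S∈)
  ... | j , x , _ , x∈ , S≡ = j , x , proj₂ (∈-filter⁻ (λ x → ¬? (x Fin.≟ a)) {xs = allFin size} x∈) , S≡

  -- A copy would lie inside the block of `f a`; reading off indices then gives an injection of `P`
  -- into itself that misses `a`.
  members-free : ¬ ContainsCopy n P members
  members-free (f , f∈ , f-inj , f-⇔) with ∈-members⁻ (f∈ a)
  ... | j , x₀ , x₀≢a , fa≡ = injective⇒¬avoids g-inj a (λ x → proj₁ (proj₂ (same-block x)) ∘ sym)
    where
    comparable⇒≡a : ∀ y → f y ⊆ f a ⊎ f a ⊆ f y → y ≡ a
    comparable⇒≡a y comparable = decidable-stable (y Fin.≟ a) λ y≢a → refute comparable (isolated y y≢a)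
      where
      refute : f y ⊆ f a ⊎ f a ⊆ f y → ¬ (¬ (a ≼ y) × ¬ (y ≼ a))
      refute (inj₁ fy⊆fa) (_ , y⋠a) = y⋠a (Equivalence.from (f-⇔ y a) fy⊆fa)
      refute (inj₂ fa⊆fy) (a⋠y , _) = a⋠y (Equivalence.from (f-⇔ a y) fa⊆fy)

    same-block : ∀ y → ∃[ x ] (¬ (x ≡ a) × f y ≡ member j x)
    same-block y with ∈-members⁻ (f∈ y)
    ... | i , x , x≢a , fy≡ with <-cmp i j
    ...   | tri≈ _ refl _ = x , x≢a , fy≡
    -- A set from another block is comparable to `f a`, so `y` is `a` itself and the index `x₀` of
    -- `f a` serves.
    ...   | tri< i<j _ _ = x₀ , x₀≢a , trans (cong f (comparable⇒≡a y
              (inj₁ (subst₂ _⊆_ (sym fy≡) (sym fa≡) (member-< i<j))))) fa≡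
    ...   | tri> _ _ j<i = x₀ , x₀≢a , trans (cong f (comparable⇒≡a y
              (inj₂ (subst₂ _⊆_ (sym fa≡) (sym fy≡) (member-< j<i))))) fa≡

    g-inj : Injective _≡_ _≡_ (proj₁ ∘ same-block)
    g-inj {y} {z} gy≡gz = f-inj (trans (proj₂ (proj₂ (same-block y)))
      (trans (cong (member j) gy≡gz) (sym (proj₂ (proj₂ (same-block z))))))

  -- Size of a `P`-free family containing the blocks

  module _ {F : List (Subset n)} (free : ¬ ContainsCopy n P F) (members⊆F : members ⊆ˡ F) where

    -- `X` in the role of `a` would complete block `j` to a copy of `P` inside `F`.
    adjoin-copy : ∀ {X j} → X ∈ F → j < m → ¬ (∀ x → ¬ (X ⊆ member j x) × ¬ (member j x ⊆ X))
    adjoin-copy {X} {j} X∈F j<m incomparable = free (f , f∈F , f-inj , λ x y → mk⇔ (f-mono x y) (f-cancel x y))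
      where
      f : Fin size → Subset n
      f x with x Fin.≟ a
      ... | yes _ = X
      ... | no  _ = member j x

      f∈F : ∀ x → f x ∈ F
      f∈F x with x Fin.≟ a
      ... | yes _   = X∈F
      ... | no  x≢a = members⊆F (∈-members⁺ j<m x≢a)

      f-mono : ∀ x y → x ≼ y → f x ⊆ f y
      f-mono x y x≼y with x Fin.≟ a | y Fin.≟ a
      ... | yes refl | yes refl = ⊆-refl
      ... | yes refl | no  y≢a  = contradiction x≼y (proj₁ (isolated y y≢a))
      ... | no  x≢a  | yes refl = contradiction x≼y (proj₂ (isolated x x≢a))
      ... | no  _    | no  _    = Equivalence.to (member-⊆⇔ j<m x y) x≼y

      f-cancel : ∀ x y → f x ⊆ f y → x ≼ y
      f-cancel x y fx⊆fy with x Fin.≟ a | y Fin.≟ a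
      ... | yes refl | yes refl = ≼-refl
      ... | yes refl | no  _    = ⊥-elim (proj₁ (incomparable y) fx⊆fy)
      ... | no  _    | yes refl = ⊥-elim (proj₂ (incomparable x) fx⊆fy)
      ... | no  _    | no  _    = Equivalence.from (member-⊆⇔ j<m x y) fx⊆fy

      f-inj : Injective _≡_ _≡_ f
      f-inj {x} {y} fx≡fy = antisym
        (f-cancel x y (subst (f x ⊆_) fx≡fy ⊆-refl))
        (f-cancel y x (subst (_⊆ f x) fx≡fy ⊆-refl))

    -- Some member of block `j` is comparable to `X`: if `X` contains it, the first alternative
    -- holds; if `X` lies in it, the second.
    split : ∀ {X j} → X ∈ F → j < m → below (j * size) ⊆ X ⊎ X ⊆ below (suc j * size)
    split {X} {j} X∈F j<m with below (j * size) ⊆? X | X ⊆? below (suc j * size)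
    ... | yes ⊆X | _      = inj₁ ⊆X
    ... | no  _  | yes X⊆ = inj₂ X⊆
    ... | no ¬⊆X | no ¬X⊆ = ⊥-elim (adjoin-copy X∈F j<m λ x →
      (λ X⊆ → ¬X⊆ (⊆-trans X⊆ (member⊆below {j}))) , (λ ⊆X → ¬⊆X (⊆-trans below⊆stack ⊆X)))

    -- Descent on `j`: step down while `X` ends by the end of block `j - 1`; once `X` contains all
    -- that precedes that block, blocks `j - 1` and `j` form the window.
    locate : ∀ {X} → X ∈ F → ∀ {j} → j ≤ m → X ⊆ below (suc j * size) →
      ∃[ i ] (i ≤ m × below (i * size) ⊆ X × X ⊆ below (i * size + (size + size)))
    -- `below 0` is empty, and the window is widened from one block to two.
    locate X∈F {zero} _ X⊆ = 0 , z≤n , (λ v∈ → contradiction (∈-below⁻ v∈) λ ()) ,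
      ⊆-trans X⊆ (below-mono (+-monoʳ-≤ size z≤n))
    locate {X} X∈F {suc j} j<m X⊆ with split X∈F j<m
    ... | inj₂ X⊆′ = locate X∈F (<⇒≤ j<m) X⊆′
    ... | inj₁ ⊆X  = j , <⇒≤ j<m , ⊆X , subst (λ b → X ⊆ below b) regroup X⊆
      where
      regroup : size + (size + j * size) ≡ j * size + (size + size)
      regroup = trans (sym (+-assoc size size (j * size))) (+-comm (size + size) (j * size))

    -- Blocks `0` to `m` cover `[n]`, so the descent can start at `m`.
    X⊆below-all : ∀ {X : Subset n} → X ⊆ below (suc m * size)
    X⊆below-all {X} {v} _ = ∈-below⁺ (<-≤-trans (Finₚ.toℕ<n v) n≤[1+m]*size)

    windows : List (Subset n)
    windows = cartesianProductWith (λ i → stack (i * size)) (upTo (suc m)) (subsets (size + size))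

    F⊆windows : F ⊆ˡ windows
    F⊆windows X∈F with locate X∈F ≤-refl X⊆below-all
    ... | i , i≤m , ⊆X , X⊆ with squeezed⇒stack ⊆X X⊆
    ...   | T , refl = ∈-cartesianProductWith⁺ (λ i → stack (i * size)) (∈-upTo⁺ (s≤s i≤m)) (∈-subsets T)

    length-bound : Unique F → length F ≤ suc m * 2 ^ (size + size)
    length-bound uniq = begin
      length F                                                        ≤⟨ Unique⇒length≤ uniq F⊆windows ⟩
      length windows                                                  ≡⟨ length-cartesianProductWith (λ i → stack (i * size)) (upTo (suc m)) (subsets (size + size)) ⟩
      length (upTo (suc m)) * length (subsets (size + size))          ≡⟨ cong₂ _*_ (length-upTo (suc m)) (length-subsets (size + size)) ⟩
      suc m * 2 ^ (size + size)                                       ∎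
      where open ≤-Reasoning

-- Discharging decidability, and the linear bound

¬¬-decidable : ∀ {m} {R : Fin m → Fin m → Set} → ¬ ¬ (∀ x y → Dec (R x y))
¬¬-decidable = sequence′ (λ x → sequence′ (λ y → ¬¬-excluded-middle))
  where
  -- Double negation commutes with products over a finite index set.
  sequence′ : ∀ {k} {Q : Fin k → Set} → (∀ i → ¬ ¬ Q i) → ¬ ¬ (∀ i → Q i)
  sequence′ = Finₚ.sequence (RawMonad.rawApplicative (¬¬-Monad {0ℓ}))

-- The inequality is decidable, hence stable, so a decision procedure for the order and a saturated
-- extension may be used although both exist only under double negation.
SatStar-bound : (P : FinPoset) → let open FinPoset P in (a : Fin size) → Isolated P a →
  ∀ n m → m * size ≤ n → n ≤ suc m * size → ∀ {k} → SatStar n P k → k ≤ suc m * 2 ^ (size + size)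
SatStar-bound P a isolated n m lower upper {k} (_ , minimal) =
  decidable-stable (k ≤? _) λ k≰ → ¬¬-decidable λ _≼?_ →
    let open Blocks P _≼?_ a isolated n m lower upper in
    extend-to-saturated P members members-unique members-free λ (F , members⊆F , sat) →
      k≰ (≤-trans (minimal F sat) (length-bound (proj₁ (proj₂ sat)) members⊆F (proj₁ sat)))

theorem3p1 : (P : FinPoset) → IsSpecial P →
    ∃[ C ] ∃[ N ] (∀ n → N ≤ n → ∀ k → SatStar n P k → k ≤ C * n)
-- The size is positive because `a` inhabits `Fin size`, so division by it makes sense.
theorem3p1 P@record { size = suc s } (a , isolated , _) = 2 * W , 1 , λ n 1≤n k sat → begin
    k                    ≤⟨ SatStar-bound P a isolated n (n / suc s) (m/n*n≤m n (suc s)) (n≤[1+n/s]*s n) sat ⟩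
    -- `1 ≤ n` absorbs the extra, possibly partial block: `1 + n / suc s ≤ n + n`.
    suc (n / suc s) * W  ≤⟨ *-monoˡ-≤ W (+-mono-≤ 1≤n (m/n≤m n (suc s))) ⟩
    (n + n) * W          ≡⟨ cong (λ t → (n + t) * W) (+-identityʳ n) ⟨
    2 * n * W            ≡⟨ *-assoc 2 n W ⟩
    2 * (n * W)          ≡⟨ cong (2 *_) (*-comm n W) ⟩
    2 * (W * n)          ≡⟨ *-assoc 2 W n ⟨
    2 * W * n            ∎
  where
  open ≤-Reasoning
  n≤[1+n/s]*s : ∀ n → n ≤ suc (n / suc s) * suc s
  n≤[1+n/s]*s n = ≤-trans (≤-reflexive (m≡m%n+[m/n]*n n (suc s)))
    (+-monoˡ-≤ (n / suc s * suc s) (<⇒≤ (m%n<n n (suc s))))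

  -- The number of subsets of a two-block window.
  W : ℕ
  W = 2 ^ (suc s + suc s)
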